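{- For any graph $G$ with no isolated vertex, $$\gamma_{oitR}(G)\leq \alpha(G)+\gamma_R(G)\leq \alpha(G)+2\gamma(G).$$
   Context: All graphs are finite, undirected and simple (no loops or multiple edges). $\alpha(G)$ is the vertex cover number: the minimum cardinality of a set of vertices such that every edge of $G$ is incident to at least one vertex of the set. $\gamma(G)$ is the domination number: the minimum cardinality of a set $D\subseteq V(G)$ such that every vertex in $V(G)\setminus D$ has a neighbor in $D$. For a function $f:V(G)\to\{0,1,2\}$, let $V_i=\{v\in V(G): f(v)=i\}$ for $i\in\{0,1,2\}$; the weight of $f$ is $\omega(f)=\sum_{v\in V(G)}f(v)$. The function $f$ is a Roman dominating function if every vertex in $V_0$ is adjacent to at least one vertex in $V_2$; the Roman domination number $\gamma_R(G)$ is the minimum weight of a Roman dominating function on $G$. The function $f$ (on a graph $G$ with no isolated vertex) is an outer-independent total Roman dominating function if (i) every vertex in $V_0$ is adjacent to at least one vertex in $V_2$; (ii) $V_0$ is an independent set; and (iii) the subgraph induced by $V_1\cup V_2$ has no isolated vertex. The outer-independent total Roman domination number $\gamma_{oitR}(G)$ is the minimum weight among all such functions. -}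

module Defs where

open import Data.Fin using (Fin; toℕ; _≟_)
open import Data.Fin.Patterns using (0F; 1F; 2F)
open import Data.Fin.Properties using (any?; all?)
open import Data.Fin.Subset using (Subset; ⊤; ∣_∣) renaming (_∈_ to _∈ˢ_; _∉_ to _∉ˢ_)
open import Data.Fin.Subset.Properties using (_∈?_; ∈⊤; anySubset?)
open import Data.Nat using (ℕ; zero; suc; _≤_; _<_; _<?_)
open import Data.Nat.Induction using (Acc; acc; <-wellFounded)
open import Data.Nat.Properties using (≮⇒≥)
open import Data.Product using (∃; _×_; _,_)
open import Data.Sum using (_⊎_; inj₁)
open import Data.Vec using (Vec; []; _∷_; lookup; map; replicate; sum)
open import Data.Vec.Properties using (lookup-replicate)
open import Level using (0ℓ)
open import Relation.Binary.Core using (Rel)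
open import Relation.Binary.Definitions using (Symmetric) renaming (Decidable to Decidable₂)
open import Relation.Binary.PropositionalEquality using (_≡_; refl; sym; trans)
open import Relation.Nullary using (¬_; Dec; yes; no; contradiction)
open import Relation.Nullary.Decidable using (¬?; _×-dec_; _⊎-dec_; _→-dec_; map′)
open import Relation.Unary using (Pred; Decidable; _∈_; _∪_)

-- Finite simple graphs; decidability of adjacency is automatic classically.
record Graph : Set₁ where
  field
    order  : ℕ
    Adj    : Rel (Fin order) 0ℓ
    adj?   : Decidable₂ Adj
    symm   : Symmetric Adj
    noLoop : ∀ {v} → ¬ Adj v v

  Vertex : Set
  Vertex = Fin order

open Graph public using (order; Vertex)

NoIsolatedVertex : Graph → Set
NoIsolatedVertex G = ∀ v → ∃ λ u → Graph.Adj G v u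

record Minimum {A : Set} (P : Pred A 0ℓ) (w : A → ℕ) : Set where
  field
    value    : ℕ
    attained : ∃ λ x → P x × w x ≡ value
    minimal  : ∀ x → P x → value ≤ w x

open Minimum public using (value)

Searchable : Set → Set₁
Searchable A = ∀ {P : Pred A 0ℓ} → Decidable P → Dec (∃ P)

minimum : ∀ {A : Set} → Searchable A → {P : Pred A 0ℓ} → Decidable P →
          (w : A → ℕ) → ∃ P → Minimum P w
minimum {A} search {P} P? w (x₀ , p₀) = descend x₀ p₀ (<-wellFounded (w x₀))
  where
  descend : ∀ x → P x → Acc _<_ (w x) → Minimum P w
  descend x p (acc rs) with search (λ y → P? y ×-dec (w y <? w x))
  ... | yes (y , q , y<x) = descend y q (rs y<x)
  ... | no  none = record
    { value    = w x
    ; attained = x , p , refl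
    ; minimal  = λ y q → ≮⇒≥ (λ y<x → none (y , q , y<x))
    }

-- A function V(G) → {0,1,2}, given by the vector of its values.
Labelling : Graph → Set
Labelling G = Vec (Fin 3) (order G)

weight : ∀ {n} → Vec (Fin 3) n → ℕ
weight f = sum (map toℕ f)

anyVec? : ∀ {k n} → Searchable (Vec (Fin k) n)
anyVec? {n = zero}  P? = map′ ([] ,_) (λ { ([] , p) → p }) (P? [])
anyVec? {n = suc _} P? =
  map′ (λ { (i , f , p) → (i ∷ f) , p }) (λ { ((i ∷ f) , p) → i , f , p })
       (any? λ i → anyVec? λ f → P? (i ∷ f))

module _ (G : Graph) where
  open Graph G using (Adj; adj?)

  IsVertexCover : Pred (Subset (order G)) 0ℓ
  IsVertexCover S = ∀ u v → Adj u v → u ∈ˢ S ⊎ v ∈ˢ S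

  IsDominating : Pred (Subset (order G)) 0ℓ
  IsDominating D = ∀ v → v ∉ˢ D → ∃ λ u → u ∈ˢ D × Adj v u

  V : Labelling G → Fin 3 → Pred (Vertex G) 0ℓ
  V f i v = lookup f v ≡ i

  Independent : Pred (Vertex G) 0ℓ → Set
  Independent X = ∀ u v → u ∈ X → v ∈ X → ¬ Adj u v

  InducesNoIsolatedVertex : Pred (Vertex G) 0ℓ → Set
  InducesNoIsolatedVertex X = ∀ v → v ∈ X → ∃ λ u → u ∈ X × Adj v u

  IsRomanDominating : Pred (Labelling G) 0ℓ
  IsRomanDominating f = ∀ v → v ∈ V f 0F → ∃ λ u → u ∈ V f 2F × Adj v u

  record IsOITRD (f : Labelling G) : Set where
    constructor mkOITRD
    field
      roman            : IsRomanDominating f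
      outerIndependent : Independent (V f 0F)
      total            : InducesNoIsolatedVertex (V f 1F ∪ V f 2F)

  isVertexCover? : Decidable IsVertexCover
  isVertexCover? S = all? λ u → all? λ v → adj? u v →-dec (u ∈? S ⊎-dec v ∈? S)

  isDominating? : Decidable IsDominating
  isDominating? D =
    all? λ v → ¬? (v ∈? D) →-dec any? λ u → u ∈? D ×-dec adj? v u

  V? : ∀ f i → Decidable (V f i)
  V? f i v = lookup f v ≟ i

  isRomanDominating? : Decidable IsRomanDominating
  isRomanDominating? f =
    all? λ v → V? f 0F v →-dec any? λ u → V? f 2F u ×-dec adj? v u

  isOITRD? : Decidable IsOITRD
  isOITRD? f =
    map′ (λ { (r , i , t) → mkOITRD r i t }) (λ { (mkOITRD r i t) → r , i , t })
         (isRomanDominating? f ×-dec ind ×-dec tot)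
    where
    positive? : Decidable (V f 1F ∪ V f 2F)
    positive? v = V? f 1F v ⊎-dec V? f 2F v
    ind : Dec (Independent (V f 0F))
    ind = all? λ u → all? λ v → V? f 0F u →-dec (V? f 0F v →-dec ¬? (adj? u v))
    tot : Dec (InducesNoIsolatedVertex (V f 1F ∪ V f 2F))
    tot = all? λ v → positive? v →-dec any? λ u → positive? u ×-dec adj? v u

  -- The constant labellings witness that the minima below are over nonempty
  -- sets.
  private
    const : Fin 3 → Labelling G
    const = replicate (order G)

    const-V : ∀ i v → v ∈ V (const i) i
    const-V i v = lookup-replicate v i

    ones-V₀ : ∀ v → ¬ (v ∈ V (const 1F) 0F)
    ones-V₀ v eq with () ← trans (sym (const-V 1F v)) eq

    twos-V₀ : ∀ v → ¬ (v ∈ V (const 2F) 0F)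
    twos-V₀ v eq with () ← trans (sym (const-V 2F v)) eq

    twos-roman : IsRomanDominating (const 2F)
    twos-roman v v∈V₀ = contradiction v∈V₀ (twos-V₀ v)

    ones-oitrd : NoIsolatedVertex G → IsOITRD (const 1F)
    ones-oitrd h = mkOITRD
      (λ v v∈V₀ → contradiction v∈V₀ (ones-V₀ v))
      (λ u _ u∈V₀ → contradiction u∈V₀ (ones-V₀ u))
      (λ v _ → let (u , vu) = h v in u , inj₁ (const-V 1F u) , vu)

  minVertexCover : Minimum IsVertexCover ∣_∣
  minVertexCover =
    minimum anySubset? isVertexCover? ∣_∣ (⊤ , λ _ _ _ → inj₁ ∈⊤)

  minDominating : Minimum IsDominating ∣_∣
  minDominating =
    minimum anySubset? isDominating? ∣_∣ (⊤ , λ _ v∉⊤ → contradiction ∈⊤ v∉⊤)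

  minRoman : Minimum IsRomanDominating weight
  minRoman = minimum anyVec? isRomanDominating? weight (const 2F , twos-roman)

  minOITRD : NoIsolatedVertex G → Minimum IsOITRD weight
  minOITRD h = minimum anyVec? isOITRD? weight (const 1F , ones-oitrd h)

  α : ℕ
  α = value minVertexCover

  γ : ℕ
  γ = value minDominating

  γR : ℕ
  γR = value minRoman

  γoitR : NoIsolatedVertex G → ℕ
  γoitR h = value (minOITRD h)

{-# OPTIONS --safe #-}
-- Let S be a minimum vertex cover and f a minimum Roman dominating function.
-- Send v ∈ S to itself if f v = 0 and to a neighbour of v otherwise, and raise
-- f from 0 to 1 on the image of S; this costs at most ∣S∣.  Then the positive
-- part contains S, so the zeros are independent and every vertex outside S has
-- a positive neighbour; a vertex of S has one by Roman domination if f v = 0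
-- and by the choice of the image otherwise.
-- For the second inequality, label a dominating set by 2.
module Submission where

open import Defs
open import Data.Bool using (if_then_else_)
open import Data.Fin using (Fin; zero; suc; toℕ; _≟_)
open import Data.Fin.Patterns using (0F; 1F; 2F)
open import Data.Fin.Subset using (Subset; inside; outside; ∣_∣) renaming (_∈_ to _∈ˢ_)
open import Data.Nat using (suc; _+_; _*_; _≤_; s≤s)
open import Data.Nat.Properties
  using (≤-refl; ≤-reflexive; ≤-trans; n≤1+n; +-suc; +-monoˡ-≤; +-monoʳ-≤; *-suc)
open import Data.Product using (∃; _×_; _,_; proj₁; proj₂)
open import Data.Sum using (_⊎_; inj₁; inj₂; [_,_]′)
open import Data.Vec using (Vec; []; _∷_; here; there; lookup; map; updateAt)
open import Data.Vec.Properties using (lookup∘updateAt)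
open import Function using (_∘_)
open import Level using (0ℓ)
open import Relation.Binary.PropositionalEquality
  using (_≡_; _≢_; refl; sym; trans; cong; cong₂)
open import Relation.Nullary using (yes; no; contradiction)
open import Relation.Nullary.Decidable using (decidable-stable)
open import Relation.Unary using (Pred)

updateAt-preserves : ∀ {A : Set} {n} {P : Pred A 0ℓ} {h : A → A} →
  (∀ {x} → P x → P (h x)) → (xs : Vec A n) (i j : Fin n) →
  P (lookup xs j) → P (lookup (updateAt xs i h) j)
updateAt-preserves h⁺ (_ ∷ _)  zero    zero    p = h⁺ p
updateAt-preserves h⁺ (_ ∷ _)  zero    (suc _) p = p
updateAt-preserves h⁺ (_ ∷ _)  (suc _) zero    p = p
updateAt-preserves {P = P} h⁺ (_ ∷ xs) (suc i) (suc j) p =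
  updateAt-preserves {P = P} h⁺ xs i j p

raise : Fin 3 → Fin 3
raise 0F = 1F
raise i  = i

raise≢0 : ∀ i → raise i ≢ 0F
raise≢0 0F ()
raise≢0 1F ()
raise≢0 2F ()

toℕ-raise : ∀ i → toℕ (raise i) ≤ suc (toℕ i)
toℕ-raise 0F = ≤-refl
toℕ-raise 1F = n≤1+n 1
toℕ-raise 2F = n≤1+n 2

≢0⇒1⊎2 : ∀ {i : Fin 3} → i ≢ 0F → i ≡ 1F ⊎ i ≡ 2F
≢0⇒1⊎2 {0F} i≢0 = contradiction refl i≢0
≢0⇒1⊎2 {1F} _   = inj₁ refl
≢0⇒1⊎2 {2F} _   = inj₂ refl

weight-updateAt-raise : ∀ {n} (f : Vec (Fin 3) n) v →
  weight (updateAt f v raise) ≤ suc (weight f)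
weight-updateAt-raise (i ∷ f) zero    = +-monoˡ-≤ (weight f) (toℕ-raise i)
weight-updateAt-raise (i ∷ f) (suc v) =
  ≤-trans (+-monoʳ-≤ (toℕ i) (weight-updateAt-raise f v))
          (≤-reflexive (+-suc (toℕ i) (weight f)))

-- Recursion runs over the members of `S`, not over the image, so a vertex hit twice by `σ` is
-- raised twice. This is harmless since `raise` fixes 1 and 2, and it lets the cost be counted as at
-- most 1 per member without injectivity of `σ`. Keeping `m` apart from `n` allows the recursive
-- call with `σ ∘ suc`.
raiseImage : ∀ {m n} → (Fin m → Fin n) → Subset m → Vec (Fin 3) n → Vec (Fin 3) n
raiseImage σ []            f = f
raiseImage σ (outside ∷ S) f = raiseImage (σ ∘ suc) S f
raiseImage σ (inside  ∷ S) f = updateAt (raiseImage (σ ∘ suc) S f) (σ zero) raise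

weight-raiseImage : ∀ {m n} (σ : Fin m → Fin n) S f →
  weight (raiseImage σ S f) ≤ ∣ S ∣ + weight f
weight-raiseImage σ []            f = ≤-refl
weight-raiseImage σ (outside ∷ S) f = weight-raiseImage (σ ∘ suc) S f
weight-raiseImage σ (inside  ∷ S) f =
  ≤-trans (weight-updateAt-raise (raiseImage (σ ∘ suc) S f) (σ zero))
          (s≤s (weight-raiseImage (σ ∘ suc) S f))

-- Kept general in `P` to serve two invariants: being nonzero, which `raise` always yields, and
-- being 2, which `raise` fixes.
raiseImage-preserves : ∀ {m n} {P : Pred (Fin 3) 0ℓ} → (∀ {i} → P i → P (raise i)) →
  (σ : Fin m → Fin n) (S : Subset m) (f : Vec (Fin 3) n) (v : Fin n) →
  P (lookup f v) → P (lookup (raiseImage σ S f) v)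
raiseImage-preserves raise⁺ σ [] f v p = p
raiseImage-preserves {P = P} raise⁺ σ (outside ∷ S) f v p =
  raiseImage-preserves {P = P} raise⁺ (σ ∘ suc) S f v p
raiseImage-preserves {P = P} raise⁺ σ (inside ∷ S) f v p =
  updateAt-preserves {P = P} raise⁺ (raiseImage (σ ∘ suc) S f) (σ zero) v
    (raiseImage-preserves {P = P} raise⁺ (σ ∘ suc) S f v p)

raiseImage-image≢0 : ∀ {m n} (σ : Fin m → Fin n) {S v} f → v ∈ˢ S →
  lookup (raiseImage σ S f) (σ v) ≢ 0F
raiseImage-image≢0 σ {inside ∷ S} f here
  rewrite lookup∘updateAt (σ zero) {raise} (raiseImage (σ ∘ suc) S f) =
    raise≢0 (lookup (raiseImage (σ ∘ suc) S f) (σ zero))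
raiseImage-image≢0 σ {outside ∷ S} f (there v∈S) = raiseImage-image≢0 (σ ∘ suc) f v∈S
-- The last update, at `σ zero`, may hit `σ (suc v)` again; `raise` never yields 0, so the entry
-- stays nonzero either way.
raiseImage-image≢0 σ {inside ∷ S} {suc v} f (there v∈S) =
  updateAt-preserves {P = _≢ 0F} (λ {i} _ → raise≢0 i) (raiseImage (σ ∘ suc) S f)
    (σ zero) (σ (suc v)) (raiseImage-image≢0 (σ ∘ suc) f v∈S)

target : (G : Graph) → NoIsolatedVertex G → Labelling G → Vertex G → Vertex G
target G h f v with lookup f v ≟ 0F
... | yes _ = v
... | no  _ = proj₁ (h v)

raisedOnCover : (G : Graph) → NoIsolatedVertex G → Subset (order G) → Labelling G → Labelling G
raisedOnCover G h S f = raiseImage (target G h f) S f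

module _ (G : Graph) (h : NoIsolatedVertex G) (S : Subset (order G)) (f : Labelling G)
         (cover : IsVertexCover G S) (roman : IsRomanDominating G f) where
  open Graph G using (Adj)

  private
    g : Labelling G
    g = raisedOnCover G h S f

    σ : Vertex G → Vertex G
    σ = target G h f

    positive⁺ : ∀ v → lookup f v ≢ 0F → lookup g v ≢ 0F
    positive⁺ = raiseImage-preserves {P = _≢ 0F} (λ {i} _ → raise≢0 i) σ S f

    V₂⁺ : ∀ v → lookup f v ≡ 2F → lookup g v ≡ 2F
    V₂⁺ = raiseImage-preserves {P = _≡ 2F} (λ { refl → refl }) σ S f

    V₀⁻ : ∀ v → lookup g v ≡ 0F → lookup f v ≡ 0F
    V₀⁻ v gv≡0 = decidable-stable (lookup f v ≟ 0F) λ fv≢0 → positive⁺ v fv≢0 gv≡0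

    cover-positive : ∀ {v} → v ∈ˢ S → lookup g v ≢ 0F
    -- The case split also evaluates `σ v` in the type of the second term: where `f` is 0 it is `v`
    -- itself, so the image fact is already the goal.
    cover-positive {v} v∈S with lookup f v ≟ 0F | raiseImage-image≢0 σ f v∈S
    ... | yes _    | gv≢0 = gv≢0
    ... | no  fv≢0 | _    = positive⁺ v fv≢0

    raisedOnCover-roman : IsRomanDominating G g
    raisedOnCover-roman v gv≡0 =
      let u , fu≡2 , vu = roman v (V₀⁻ v gv≡0) in u , V₂⁺ u fu≡2 , vu

    raisedOnCover-independent : Independent G (V G g 0F)
    raisedOnCover-independent u v gu≡0 gv≡0 uv =
      [ (λ u∈S → cover-positive u∈S gu≡0) , (λ v∈S → cover-positive v∈S gv≡0) ]′
        (cover u v uv)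

    cover-total : ∀ {v} → v ∈ˢ S → ∃ λ u → lookup g u ≢ 0F × Adj v u
    cover-total {v} v∈S with lookup f v ≟ 0F | raiseImage-image≢0 σ f v∈S
    ... | no  _    | gu≢0 = proj₁ (h v) , gu≢0 , proj₂ (h v)
    -- The neighbour that defends `v` under `f` keeps its label 2 in `g`, hence is positive there.
    ... | yes fv≡0 | _    =
      let u , fu≡2 , vu = roman v fv≡0
      in u , (λ gu≡0 → contradiction (trans (sym (V₂⁺ u fu≡2)) gu≡0) λ ()) , vu

    positive-neighbour : ∀ v → ∃ λ u → lookup g u ≢ 0F × Adj v u
    -- One edge at `v` suffices: `cover` puts `v` or its chosen neighbour in `S`, and in the latter
    -- case that neighbour is positive.
    positive-neighbour v with cover v (proj₁ (h v)) (proj₂ (h v))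
    ... | inj₁ v∈S = cover-total v∈S
    ... | inj₂ u∈S = proj₁ (h v) , cover-positive u∈S , proj₂ (h v)

  raisedOnCover-oitrd : IsOITRD G (raisedOnCover G h S f)
  raisedOnCover-oitrd = mkOITRD raisedOnCover-roman raisedOnCover-independent λ v _ →
    let u , gu≢0 , vu = positive-neighbour v in u , ≢0⇒1⊎2 gu≢0 , vu

doubleIndicator : ∀ {n} → Subset n → Vec (Fin 3) n
doubleIndicator = map (λ b → if b then 2F else 0F)

weight-doubleIndicator : ∀ {n} (D : Subset n) → weight (doubleIndicator D) ≡ 2 * ∣ D ∣
weight-doubleIndicator []            = refl
weight-doubleIndicator (outside ∷ D) = weight-doubleIndicator D
weight-doubleIndicator (inside  ∷ D) =
  trans (cong (2 +_) (weight-doubleIndicator D)) (sym (*-suc 2 ∣ D ∣))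

∈⇒doubleIndicator≡2 : ∀ {n} {D : Subset n} {v} → v ∈ˢ D → lookup (doubleIndicator D) v ≡ 2F
∈⇒doubleIndicator≡2 here        = refl
∈⇒doubleIndicator≡2 (there v∈D) = ∈⇒doubleIndicator≡2 v∈D

doubleIndicator-roman : ∀ (G : Graph) D → IsDominating G D →
  IsRomanDominating G (doubleIndicator D)
doubleIndicator-roman G D dominating v v∈V₀ =
  -- Members of `D` carry 2, so a vertex labelled 0 lies outside `D` and domination applies to it.
  let u , u∈D , vu = dominating v λ v∈D →
        contradiction (trans (sym (∈⇒doubleIndicator≡2 v∈D)) v∈V₀) λ ()
  in u , ∈⇒doubleIndicator≡2 u∈D , vu

γoitR≤α+γR : (G : Graph) (h : NoIsolatedVertex G) → γoitR G h ≤ α G + γR G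
γoitR≤α+γR G h
  with S , cover , ∣S∣≡α  ← Minimum.attained (minVertexCover G)
     | f , roman , wf≡γR ← Minimum.attained (minRoman G)
  -- Both `S` and `f` are optimal, so the bound `∣ S ∣ + weight f` on the raised labelling is
  -- exactly `α G + γR G`.
  = ≤-trans (Minimum.minimal (minOITRD G h) (raisedOnCover G h S f)
            (raisedOnCover-oitrd G h S f cover roman))
   (≤-trans (weight-raiseImage (target G h f) S f)
            (≤-reflexive (cong₂ _+_ ∣S∣≡α wf≡γR)))

γR≤2γ : (G : Graph) → γR G ≤ 2 * γ G
γR≤2γ G with D , dominating , ∣D∣≡γ ← Minimum.attained (minDominating G) =
  ≤-trans (Minimum.minimal (minRoman G) (doubleIndicator D) (doubleIndicator-roman G D dominating))
          (≤-reflexive (trans (weight-doubleIndicator D) (cong (2 *_) ∣D∣≡γ)))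

theorem2p5 : (G : Graph) (h : NoIsolatedVertex G) →
    (γoitR G h ≤ α G + γR G) × (α G + γR G ≤ α G + 2 * γ G)
theorem2p5 G h = γoitR≤α+γR G h , +-monoʳ-≤ (α G) (γR≤2γ G)
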